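{- Let $M,N$ be typable terms of the simply typed $\lambda$-calculus such that $M\to_\beta N$. Then $\mathcal{W}(M)>\mathcal{W}(N)$, where $\mathcal{W}(M)\in\mathbb{N}_0$ is the number of wrappers in the full simplification $\mathtt{S}_*(M)$ of $M$ (regarded as a $\lambda^{\mathbf m}$-term).
   Context: Simple types: $A::=\alpha\mid A\to B$ with $\alpha$ ranging over base types. Terms of the simply typed $\lambda$-calculus (STLC, Church style, up to $\alpha$-renaming): $M::=x^A\mid\lambda x^A.M\mid M\,N$, with usual typing; $\to_\beta$ is the closure under contexts of $(\lambda x.M)\,N\to_\beta M[x:=N]$. $\lambda^{\mathbf m}$-terms: $t,s::=x^A\mid\lambda x^A.t\mid t\,s\mid t\{s\}$ (up to $\alpha$-renaming). A term $t\{s\}$ is called a wrapper. Typing: the usual STLC rules plus: $\Gamma\vdash t:A$ and $\Gamma\vdash s:B$ imply $\Gamma\vdash t\{s\}:A$. Typable terms have a unique type. Every $\lambda$-term is also a $\lambda^{\mathbf m}$-term (without wrappers). Memories: $L::=\Box\mid L\{t\}$; if $L=\Box\{s_1\}\dots\{s_n\}$, then $tL$ denotes $t\{s_1\}\dots\{s_n\}$. An $\mathbf m$-abstraction is a term $(\lambda x.t)L$ (possibly $L=\Box$); its degree is the height of its type, where $\mathsf h(\alpha)=0$ and $\mathsf h(A\to B)=1+\max(\mathsf h(A),\mathsf h(B))$. A redex is a term $(\lambda x.t)L\,s$; its degree is the degree of $(\lambda x.t)L$. $\mathsf{maxdeg}(t)$ is the maximum degree of the redexes occurring in $t$, or $0$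 if there are none. For $d\ge1$, the simplification of degree $d$ is defined by: $\mathtt S_d(x)=x$; $\mathtt S_d(\lambda x.t)=\lambda x.\mathtt S_d(t)$; $\mathtt S_d(t\,s)=\mathtt S_d(t')[x:=\mathtt S_d(s)]\{\mathtt S_d(s)\}\mathtt S_d(L)$ if $t=(\lambda x.t')L$ is of degree $d$, and $\mathtt S_d(t\,s)=\mathtt S_d(t)\,\mathtt S_d(s)$ otherwise; $\mathtt S_d(t\{s\})=\mathtt S_d(t)\{\mathtt S_d(s)\}$; on memories, $\mathtt S_d(\Box)=\Box$ and $\mathtt S_d(L\{t\})=\mathtt S_d(L)\{\mathtt S_d(t)\}$. Full simplification: $\mathtt S_*(t)=\mathtt S_1(\mathtt S_2(\dots\mathtt S_D(t)))$ where $D=\mathsf{maxdeg}(t)$. The weight $\mathsf w(t)$ is the number of wrappers (occurrences of subterms of the form $s\{u\}$) in $t$. For a typable $\lambda$-term $M$, $\mathcal W(M)=\mathsf w(\mathtt S_*(M))$. -}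

module Defs where

open import Data.List.Base using (List; _∷_)
open import Data.List.Membership.Propositional using (_∈_)
open import Data.List.Relation.Unary.Any using (here; there)
open import Data.Nat.Base using (ℕ; zero; suc; _+_; _⊔_)
open import Data.Nat.Properties using (_≟_)
open import Data.Product.Base using (_×_; _,_)
open import Relation.Binary.PropositionalEquality
  using (_≡_; refl; cong; cong₂)
open import Relation.Nullary.Decidable.Core using (Dec; yes; no; _×-dec_)
open import Relation.Nullary.Negation.Core using (¬_; contradiction)

infixr 7 _⇒_

data Ty (Base : Set) : Set where
  base : Base → Ty Base
  _⇒_  : Ty Base → Ty Base → Ty Base

Ctx : Set → Set
Ctx Base = List (Ty Base)

variable
  Base  : Set
  A B C : Ty Base
  Γ Δ   : Ctx Base

height : Ty Base → ℕ
height (base _) = 0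
height (A ⇒ B)  = suc (height A ⊔ height B)

-- Both calculi are intrinsically typed with de Bruijn indices: terms up to
-- α-renaming together with their (unique) type, a variable being a
-- membership proof in the context.

Ren : Ctx Base → Ctx Base → Set
Ren Γ Δ = ∀ {A} → A ∈ Γ → A ∈ Δ

extᴿ : Ren Γ Δ → Ren (C ∷ Γ) (C ∷ Δ)
extᴿ ρ (here e)  = here e
extᴿ ρ (there x) = there (ρ x)

module STLC where

  infix  4 _⊢_ _→β_
  infixr 5 ƛ_
  infixl 7 _·_
  infix  8 _[_]
  infix  9 `_

  data _⊢_ {Base : Set} : Ctx Base → Ty Base → Set where
    `_  : A ∈ Γ → Γ ⊢ A
    ƛ_  : A ∷ Γ ⊢ B → Γ ⊢ A ⇒ B
    _·_ : Γ ⊢ A ⇒ B → Γ ⊢ A → Γ ⊢ B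

  rename : Ren Γ Δ → Γ ⊢ A → Δ ⊢ A
  rename ρ (` x)   = ` ρ x
  rename ρ (ƛ M)   = ƛ rename (extᴿ ρ) M
  rename ρ (M · N) = rename ρ M · rename ρ N

  Sub : Ctx Base → Ctx Base → Set
  Sub Γ Δ = ∀ {A} → A ∈ Γ → Δ ⊢ A

  ext : Sub Γ Δ → Sub (C ∷ Γ) (C ∷ Δ)
  ext σ (here e)  = ` here e
  ext σ (there x) = rename there (σ x)

  subst : Sub Γ Δ → Γ ⊢ A → Δ ⊢ A
  subst σ (` x)   = σ x
  subst σ (ƛ M)   = ƛ subst (ext σ) M
  subst σ (M · N) = subst σ M · subst σ N

  single : Γ ⊢ C → Sub (C ∷ Γ) Γ
  single N (here refl) = N
  single N (there x)   = ` x

  _[_] : C ∷ Γ ⊢ A → Γ ⊢ C → Γ ⊢ A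
  M [ N ] = subst (single N) M

  data _→β_ {Base : Set} : {Γ : Ctx Base} {A : Ty Base} → Γ ⊢ A → Γ ⊢ A → Set where
    β   : {M : A ∷ Γ ⊢ B} {N : Γ ⊢ A} → (ƛ M) · N →β M [ N ]
    ξƛ  : {M M′ : A ∷ Γ ⊢ B} → M →β M′ → ƛ M →β ƛ M′
    ξ·ˡ : {M M′ : Γ ⊢ A ⇒ B} {N : Γ ⊢ A} → M →β M′ → M · N →β M′ · N
    ξ·ʳ : {M : Γ ⊢ A ⇒ B} {N N′ : Γ ⊢ A} → N →β N′ → M · N →β M · N′

module Mem where

  infix  4 _⊢_
  infixr 5 ƛ_
  infixl 6 _◃_
  infixl 7 _·_
  infixl 8 _[_] _⟨_⟩
  infix  9 `_

  -- t ⟨ s ⟩ is the wrapper t{s}.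
  data _⊢_ {Base : Set} : Ctx Base → Ty Base → Set where
    `_   : A ∈ Γ → Γ ⊢ A
    ƛ_   : A ∷ Γ ⊢ B → Γ ⊢ A ⇒ B
    _·_  : Γ ⊢ A ⇒ B → Γ ⊢ A → Γ ⊢ B
    _⟨_⟩ : Γ ⊢ A → Γ ⊢ B → Γ ⊢ A

  rename : Ren Γ Δ → Γ ⊢ A → Δ ⊢ A
  rename ρ (` x)     = ` ρ x
  rename ρ (ƛ t)     = ƛ rename (extᴿ ρ) t
  rename ρ (t · s)   = rename ρ t · rename ρ s
  rename ρ (t ⟨ s ⟩) = rename ρ t ⟨ rename ρ s ⟩

  Sub : Ctx Base → Ctx Base → Set
  Sub Γ Δ = ∀ {A} → A ∈ Γ → Δ ⊢ A

  ext : Sub Γ Δ → Sub (C ∷ Γ) (C ∷ Δ)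
  ext σ (here e)  = ` here e
  ext σ (there x) = rename there (σ x)

  subst : Sub Γ Δ → Γ ⊢ A → Δ ⊢ A
  subst σ (` x)     = σ x
  subst σ (ƛ t)     = ƛ subst (ext σ) t
  subst σ (t · s)   = subst σ t · subst σ s
  subst σ (t ⟨ s ⟩) = subst σ t ⟨ subst σ s ⟩

  single : Γ ⊢ C → Sub (C ∷ Γ) Γ
  single s (here refl) = s
  single s (there x)   = ` x

  _[_] : C ∷ Γ ⊢ A → Γ ⊢ C → Γ ⊢ A
  t [ s ] = subst (single s) t

  data Memory {Base : Set} (Γ : Ctx Base) : Set where
    □    : Memory Γ
    _⟨_⟩ : Memory Γ → Γ ⊢ A → Memory Γ

  -- t ◃ L is tL.
  _◃_ : Γ ⊢ A → Memory Γ → Γ ⊢ A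
  t ◃ □         = t
  t ◃ (L ⟨ s ⟩) = (t ◃ L) ⟨ s ⟩

  -- MAbs t: t is an m-abstraction (λx.t′)L; see mabs-◃ and MAbs⇒◃.
  data MAbs {Base : Set} {Γ : Ctx Base} {A B : Ty Base} : Γ ⊢ A ⇒ B → Set where
    ƛ_   : (t : A ∷ Γ ⊢ B) → MAbs (ƛ t)
    _⟨_⟩ : {t : Γ ⊢ A ⇒ B} → MAbs t → (s : Γ ⊢ C) → MAbs (t ⟨ s ⟩)

  mabs? : (t : Γ ⊢ A ⇒ B) → Dec (MAbs t)
  mabs? (` x)     = no λ ()
  mabs? (ƛ t)     = yes (ƛ t)
  mabs? (t · s)   = no λ ()
  mabs? (t ⟨ s ⟩) with mabs? t
  ... | yes p = yes (p ⟨ s ⟩)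
  ... | no ¬p = no λ { (p ⟨ _ ⟩) → ¬p p }

  body : {t : Γ ⊢ A ⇒ B} → MAbs t → A ∷ Γ ⊢ B
  body (ƛ t)     = t
  body (p ⟨ s ⟩) = body p

  memory : {t : Γ ⊢ A ⇒ B} → MAbs t → Memory Γ
  memory (ƛ t)     = □
  memory (p ⟨ s ⟩) = memory p ⟨ s ⟩

  mabs-◃ : (t : A ∷ Γ ⊢ B) (L : Memory Γ) → MAbs ((ƛ t) ◃ L)
  mabs-◃ t □         = ƛ t
  mabs-◃ t (L ⟨ s ⟩) = mabs-◃ t L ⟨ s ⟩

  MAbs⇒◃ : {t : Γ ⊢ A ⇒ B} (p : MAbs t) → t ≡ (ƛ body p) ◃ memory p
  MAbs⇒◃ (ƛ t)     = refl
  MAbs⇒◃ (p ⟨ s ⟩) = cong (_⟨ s ⟩) (MAbs⇒◃ p)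

  degree : {t : Γ ⊢ A ⇒ B} → MAbs t → ℕ
  degree {A = A} {B = B} _ = height (A ⇒ B)

  -- The degree of t · s when it is a redex, and 0 otherwise.
  redexDegree : Γ ⊢ A ⇒ B → Γ ⊢ A → ℕ
  redexDegree t s with mabs? t
  ... | yes p = degree p
  ... | no  _ = 0

  maxdeg : Γ ⊢ A → ℕ
  maxdeg (` x)     = 0
  maxdeg (ƛ t)     = maxdeg t
  maxdeg (t · s)   = redexDegree t s ⊔ (maxdeg t ⊔ maxdeg s)
  maxdeg (t ⟨ s ⟩) = maxdeg t ⊔ maxdeg s

  -- For t = (λx.t′)L, simplifyBody and simplifyMemory compute S_d(t′) and
  -- S_d(L) by recursion on t, so that the definition is structural; the
  -- equations for S_d(t s) in terms of t′ and L are simplify-redex and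
  -- simplify-nonredex.
  simplify       : ℕ → Γ ⊢ A → Γ ⊢ A
  simplifyBody   : ℕ → (t : Γ ⊢ A ⇒ B) → MAbs t → A ∷ Γ ⊢ B
  simplifyMemory : ℕ → (t : Γ ⊢ A ⇒ B) → MAbs t → Memory Γ

  simplify d (` x)     = ` x
  simplify d (ƛ t)     = ƛ simplify d t
  simplify d (t ⟨ s ⟩) = simplify d t ⟨ simplify d s ⟩
  simplify d (_·_ {A = A} {B = B} t s) with mabs? t ×-dec (height (A ⇒ B) ≟ d)
  ... | yes (p , _) =
    simplifyBody d t p [ simplify d s ] ⟨ simplify d s ⟩ ◃ simplifyMemory d t p
  ... | no _ = simplify d t · simplify d s

  simplifyBody d (ƛ t)     _         = simplify d t
  simplifyBody d (t ⟨ s ⟩) (p ⟨ _ ⟩) = simplifyBody d t p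

  simplifyMemory d (ƛ t)     _         = □
  simplifyMemory d (t ⟨ s ⟩) (p ⟨ _ ⟩) = simplifyMemory d t p ⟨ simplify d s ⟩

  simplifyᴸ : ℕ → Memory Γ → Memory Γ
  simplifyᴸ d □         = □
  simplifyᴸ d (L ⟨ t ⟩) = simplifyᴸ d L ⟨ simplify d t ⟩

  simplifyBody-◃ : ∀ d (t : A ∷ Γ ⊢ B) (L : Memory Γ) (p : MAbs ((ƛ t) ◃ L)) →
                   simplifyBody d ((ƛ t) ◃ L) p ≡ simplify d t
  simplifyBody-◃ d t □         _         = refl
  simplifyBody-◃ d t (L ⟨ s ⟩) (p ⟨ _ ⟩) = simplifyBody-◃ d t L p

  simplifyMemory-◃ : ∀ d (t : A ∷ Γ ⊢ B) (L : Memory Γ) (p : MAbs ((ƛ t) ◃ L)) →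
                     simplifyMemory d ((ƛ t) ◃ L) p ≡ simplifyᴸ d L
  simplifyMemory-◃ d t □         _         = refl
  simplifyMemory-◃ d t (L ⟨ s ⟩) (p ⟨ _ ⟩) =
    cong (_⟨ simplify d s ⟩) (simplifyMemory-◃ d t L p)

  simplify-redex : ∀ d (t : A ∷ Γ ⊢ B) (L : Memory Γ) (s : Γ ⊢ A) →
    height (A ⇒ B) ≡ d →
    simplify d (((ƛ t) ◃ L) · s) ≡
      simplify d t [ simplify d s ] ⟨ simplify d s ⟩ ◃ simplifyᴸ d L
  simplify-redex {A = A} {B = B} d t L s h≡d
    with mabs? ((ƛ t) ◃ L) ×-dec (height (A ⇒ B) ≟ d)
  ... | yes (p , _) =
    cong₂ (λ u K → u [ simplify d s ] ⟨ simplify d s ⟩ ◃ K)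
      (simplifyBody-◃ d t L p) (simplifyMemory-◃ d t L p)
  ... | no ¬p = contradiction (mabs-◃ t L , h≡d) ¬p

  simplify-nonredex : ∀ d (t : Γ ⊢ A ⇒ B) (s : Γ ⊢ A) →
    ¬ (MAbs t × height (A ⇒ B) ≡ d) →
    simplify d (t · s) ≡ simplify d t · simplify d s
  simplify-nonredex {A = A} {B = B} d t s ¬p
    with mabs? t ×-dec (height (A ⇒ B) ≟ d)
  ... | yes p = contradiction p ¬p
  ... | no _  = refl

  -- simplifyFrom D t = S_1(S_2(… S_D(t)))
  simplifyFrom : ℕ → Γ ⊢ A → Γ ⊢ A
  simplifyFrom zero    t = t
  simplifyFrom (suc d) t = simplifyFrom d (simplify (suc d) t)

  simplify* : Γ ⊢ A → Γ ⊢ A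
  simplify* t = simplifyFrom (maxdeg t) t

  weight : Γ ⊢ A → ℕ
  weight (` x)     = 0
  weight (ƛ t)     = weight t
  weight (t · s)   = weight t + weight s
  weight (t ⟨ s ⟩) = suc (weight t + weight s)

⌜_⌝ : Γ STLC.⊢ A → Γ Mem.⊢ A
⌜ STLC.` x ⌝   = Mem.` x
⌜ STLC.ƛ M ⌝   = Mem.ƛ ⌜ M ⌝
⌜ M STLC.· N ⌝ = ⌜ M ⌝ Mem.· ⌜ N ⌝

𝒲 : Γ STLC.⊢ A → ℕ
𝒲 M = Mem.weight (Mem.simplify* ⌜ M ⌝)

open STLC public using (_⊢_; _→β_)

{-# OPTIONS --safe #-}
module Submission where

-- Let t ⊒ t′ mean that t′ arises from t by contracting redexes of one fixed
-- degree k, discarding their memory and argument copy, and by erasing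
-- wrappers.  A β-step of degree k is such a step.  Contracting redexes of
-- degree d only creates redexes of smaller degree, so S_d preserves ⊒ for
-- d > k.  S_k itself contracts the remaining redexes of degree k, but keeps
-- in wrappers what β discards; after it only erasure of wrappers is left,
-- at least one of them if a β-step was performed, and erasure is preserved
-- by every S_d.

open import Data.Bool.Base using (Bool; true; false; _∨_)
open import Data.Bool.Properties using (∨-assoc; ∨-comm)
open import Data.List.Base using (_∷_)
open import Data.List.Membership.Propositional using (_∈_)
open import Data.List.Relation.Unary.Any using (here; there)
open import Data.Nat.Base
open import Data.Nat.Properties
open import Data.Product.Base using (_×_; _,_; ∃)
open import Data.Sum.Base using (_⊎_; inj₁; inj₂)
open import Function.Base using (case_of_)
open import Relation.Binary.PropositionalEquality as ≡
  using (_≡_; _≢_; refl; sym; trans; cong; cong₂)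
open import Relation.Nullary.Decidable.Core using (yes; no; _×-dec_)
open import Relation.Nullary.Negation.Core using (contradiction)
open import Defs
open Mem hiding (_⊢_)

private variable
  Θ : Ctx Base

infix 4 _⊢ᵐ_
_⊢ᵐ_ : Ctx Base → Ty Base → Set
_⊢ᵐ_ = Mem._⊢_

-- Substitution calculus

rename-cong : {ρ ρ′ : Ren Γ Δ} → (∀ {A} (x : A ∈ Γ) → ρ x ≡ ρ′ x) →
              (t : Γ ⊢ᵐ A) → rename ρ t ≡ rename ρ′ t
rename-cong e (` x)     = cong `_ (e x)
rename-cong e (ƛ t)     =
  cong ƛ_ (rename-cong (λ { (here _) → refl ; (there x) → cong there (e x) }) t)
rename-cong e (t · s)   = cong₂ _·_ (rename-cong e t) (rename-cong e s)
rename-cong e (t ⟨ s ⟩) = cong₂ _⟨_⟩ (rename-cong e t) (rename-cong e s)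

subst-cong : {σ τ : Sub Γ Δ} → (∀ {A} (x : A ∈ Γ) → σ x ≡ τ x) →
             (t : Γ ⊢ᵐ A) → subst σ t ≡ subst τ t
subst-cong e (` x)     = e x
subst-cong e (ƛ t)     =
  cong ƛ_ (subst-cong (λ { (here _) → refl ; (there x) → cong (rename there) (e x) }) t)
subst-cong e (t · s)   = cong₂ _·_ (subst-cong e t) (subst-cong e s)
subst-cong e (t ⟨ s ⟩) = cong₂ _⟨_⟩ (subst-cong e t) (subst-cong e s)

subst-id : {σ : Sub Γ Γ} → (∀ {A} (x : A ∈ Γ) → σ x ≡ ` x) →
           (t : Γ ⊢ᵐ A) → subst σ t ≡ t
subst-id e (` x)     = e x
subst-id e (ƛ t)     =
  cong ƛ_ (subst-id (λ { (here _) → refl ; (there x) → cong (rename there) (e x) }) t)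
subst-id e (t · s)   = cong₂ _·_ (subst-id e t) (subst-id e s)
subst-id e (t ⟨ s ⟩) = cong₂ _⟨_⟩ (subst-id e t) (subst-id e s)

rename-rename : (ρ′ : Ren Δ Θ) (ρ : Ren Γ Δ) (t : Γ ⊢ᵐ A) →
                rename ρ′ (rename ρ t) ≡ rename (λ x → ρ′ (ρ x)) t
rename-rename ρ′ ρ (` x)     = refl
rename-rename ρ′ ρ (ƛ t)     = cong ƛ_
  (trans (rename-rename (extᴿ ρ′) (extᴿ ρ) t)
         (rename-cong (λ { (here _) → refl ; (there x) → refl }) t))
rename-rename ρ′ ρ (t · s)   = cong₂ _·_ (rename-rename ρ′ ρ t) (rename-rename ρ′ ρ s)
rename-rename ρ′ ρ (t ⟨ s ⟩) = cong₂ _⟨_⟩ (rename-rename ρ′ ρ t) (rename-rename ρ′ ρ s)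

subst-rename : (σ : Sub Δ Θ) (ρ : Ren Γ Δ) (t : Γ ⊢ᵐ A) →
               subst σ (rename ρ t) ≡ subst (λ x → σ (ρ x)) t
subst-rename σ ρ (` x)     = refl
subst-rename σ ρ (ƛ t)     = cong ƛ_
  (trans (subst-rename (ext σ) (extᴿ ρ) t)
         (subst-cong (λ { (here _) → refl ; (there x) → refl }) t))
subst-rename σ ρ (t · s)   = cong₂ _·_ (subst-rename σ ρ t) (subst-rename σ ρ s)
subst-rename σ ρ (t ⟨ s ⟩) = cong₂ _⟨_⟩ (subst-rename σ ρ t) (subst-rename σ ρ s)

rename-extᴿ-there : (ρ : Ren Γ Δ) (t : Γ ⊢ᵐ A) →
                    rename (extᴿ {C = C} ρ) (rename there t) ≡ rename there (rename ρ t)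
rename-extᴿ-there ρ t =
  trans (rename-rename (extᴿ ρ) there t) (sym (rename-rename there ρ t))

rename-subst : (ρ : Ren Δ Θ) (σ : Sub Γ Δ) (t : Γ ⊢ᵐ A) →
               rename ρ (subst σ t) ≡ subst (λ x → rename ρ (σ x)) t
rename-subst ρ σ (` x)     = refl
rename-subst ρ σ (ƛ t)     = cong ƛ_
  (trans (rename-subst (extᴿ ρ) (ext σ) t)
         (subst-cong (λ { (here _) → refl ; (there x) → rename-extᴿ-there ρ (σ x) }) t))
rename-subst ρ σ (t · s)   = cong₂ _·_ (rename-subst ρ σ t) (rename-subst ρ σ s)
rename-subst ρ σ (t ⟨ s ⟩) = cong₂ _⟨_⟩ (rename-subst ρ σ t) (rename-subst ρ σ s)

subst-ext-there : (σ : Sub Γ Δ) (t : Γ ⊢ᵐ A) →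
                  subst (ext {C = C} σ) (rename there t) ≡ rename there (subst σ t)
subst-ext-there σ t =
  trans (subst-rename (ext σ) there t) (sym (rename-subst there σ t))

subst-subst : (τ : Sub Δ Θ) (σ : Sub Γ Δ) (t : Γ ⊢ᵐ A) →
              subst τ (subst σ t) ≡ subst (λ x → subst τ (σ x)) t
subst-subst τ σ (` x)     = refl
subst-subst τ σ (ƛ t)     = cong ƛ_
  (trans (subst-subst (ext τ) (ext σ) t)
         (subst-cong (λ { (here _) → refl ; (there x) → subst-ext-there τ (σ x) }) t))
subst-subst τ σ (t · s)   = cong₂ _·_ (subst-subst τ σ t) (subst-subst τ σ s)
subst-subst τ σ (t ⟨ s ⟩) = cong₂ _⟨_⟩ (subst-subst τ σ t) (subst-subst τ σ s)

rename-[] : (ρ : Ren Γ Δ) (t : C ∷ Γ ⊢ᵐ A) (s : Γ ⊢ᵐ C) →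
            rename ρ (t [ s ]) ≡ rename (extᴿ ρ) t [ rename ρ s ]
rename-[] ρ t s =
  trans (rename-subst ρ (single s) t)
  (trans (subst-cong (λ { (here refl) → refl ; (there x) → refl }) t)
         (sym (subst-rename (single (rename ρ s)) (extᴿ ρ) t)))

subst-[] : (σ : Sub Γ Δ) (t : C ∷ Γ ⊢ᵐ A) (s : Γ ⊢ᵐ C) →
           subst σ (t [ s ]) ≡ subst (ext σ) t [ subst σ s ]
subst-[] σ t s =
  trans (subst-subst σ (single s) t)
  (trans (subst-cong
           (λ { (here refl) → refl
              ; (there x)   → sym (trans (subst-rename (single (subst σ s)) there (σ x))
                                         (subst-id (λ _ → refl) (σ x))) }) t)
         (sym (subst-subst (single (subst σ s)) (ext σ) t)))

-- m-abstractions and their contraction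

rename-mabs : (ρ : Ren Γ Δ) {t : Γ ⊢ᵐ A ⇒ B} → MAbs t → MAbs (rename ρ t)
rename-mabs ρ (ƛ t)     = ƛ rename (extᴿ ρ) t
rename-mabs ρ (p ⟨ s ⟩) = rename-mabs ρ p ⟨ rename ρ s ⟩

rename-mabs⁻ : (ρ : Ren Γ Δ) (t : Γ ⊢ᵐ A ⇒ B) → MAbs (rename ρ t) → MAbs t
rename-mabs⁻ ρ (ƛ t)     _         = ƛ t
rename-mabs⁻ ρ (t ⟨ s ⟩) (p ⟨ _ ⟩) = rename-mabs⁻ ρ t p ⟨ s ⟩

subst-mabs : (σ : Sub Γ Δ) {t : Γ ⊢ᵐ A ⇒ B} → MAbs t → MAbs (subst σ t)
subst-mabs σ (ƛ t)     = ƛ subst (ext σ) t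
subst-mabs σ (p ⟨ s ⟩) = subst-mabs σ p ⟨ subst σ s ⟩

simplify-mabs : ∀ d {t : Γ ⊢ᵐ A ⇒ B} → MAbs t → MAbs (simplify d t)
simplify-mabs d (ƛ t)     = ƛ simplify d t
simplify-mabs d (p ⟨ s ⟩) = simplify-mabs d p ⟨ simplify d s ⟩

mabs-irrelevant : {t : Γ ⊢ᵐ A ⇒ B} (p q : MAbs t) → p ≡ q
mabs-irrelevant (ƛ t)     (ƛ .t)     = refl
mabs-irrelevant (p ⟨ s ⟩) (q ⟨ .s ⟩) = cong (_⟨ s ⟩) (mabs-irrelevant p q)

-- The result `t′ [ s ] ⟨ s ⟩ ◃ L` of simplifying a redex, by recursion on the m-abstraction, so
-- that proofs strip its memory one wrapper at a time.
contract : {t : Γ ⊢ᵐ A ⇒ B} → MAbs t → Γ ⊢ᵐ A → Γ ⊢ᵐ B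
contract (ƛ t)     s = t [ s ] ⟨ s ⟩
contract (p ⟨ u ⟩) s = contract p s ⟨ u ⟩

-- Witnesses of `MAbs` arise by different routes, such as renaming before or after simplifying; by
-- irrelevance only the terms matter.
contract-cong : {t t′ : Γ ⊢ᵐ A ⇒ B} {s s′ : Γ ⊢ᵐ A} (p : MAbs t) (p′ : MAbs t′) →
                t ≡ t′ → s ≡ s′ → contract p s ≡ contract p′ s′
contract-cong {s = s} p p′ refl refl = cong (λ q → contract q s) (mabs-irrelevant p p′)

contract-rename : (ρ : Ren Γ Δ) {t : Γ ⊢ᵐ A ⇒ B} (p : MAbs t) (s : Γ ⊢ᵐ A) →
                  rename ρ (contract p s) ≡ contract (rename-mabs ρ p) (rename ρ s)
contract-rename ρ (ƛ t)     s = cong (_⟨ rename ρ s ⟩) (rename-[] ρ t s)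
contract-rename ρ (p ⟨ u ⟩) s = cong (_⟨ rename ρ u ⟩) (contract-rename ρ p s)

contract-subst : (σ : Sub Γ Δ) {t : Γ ⊢ᵐ A ⇒ B} (p : MAbs t) (s : Γ ⊢ᵐ A) →
                 subst σ (contract p s) ≡ contract (subst-mabs σ p) (subst σ s)
contract-subst σ (ƛ t)     s = cong (_⟨ subst σ s ⟩) (subst-[] σ t s)
contract-subst σ (p ⟨ u ⟩) s = cong (_⟨ subst σ u ⟩) (contract-subst σ p s)

simplifyBody-contract : ∀ d {t : Γ ⊢ᵐ A ⇒ B} (p : MAbs t) (s : Γ ⊢ᵐ A) →
  simplifyBody d t p [ s ] ⟨ s ⟩ ◃ simplifyMemory d t p ≡ contract (simplify-mabs d p) s
simplifyBody-contract d (ƛ t)     s = refl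
simplifyBody-contract d (p ⟨ u ⟩) s = cong (_⟨ simplify d u ⟩) (simplifyBody-contract d p s)

simplify-contract : ∀ d {t : Γ ⊢ᵐ A ⇒ B} (p : MAbs t) (s : Γ ⊢ᵐ A) → height (A ⇒ B) ≡ d →
                    simplify d (t · s) ≡ contract (simplify-mabs d p) (simplify d s)
simplify-contract {A = A} {B = B} d {t} p s h≡d with mabs? t ×-dec (height (A ⇒ B) ≟ d)
... | yes (q , _) = trans (simplifyBody-contract d q (simplify d s))
  (contract-cong (simplify-mabs d q) (simplify-mabs d p) refl refl)
... | no ¬p       = contradiction (p , h≡d) ¬p

-- Simplification and substitution

simplify-rename : ∀ d (ρ : Ren Γ Δ) (t : Γ ⊢ᵐ A) →
                  simplify d (rename ρ t) ≡ rename ρ (simplify d t)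
simplify-rename d ρ (` x)     = refl
simplify-rename d ρ (ƛ t)     = cong ƛ_ (simplify-rename d (extᴿ ρ) t)
simplify-rename d ρ (t ⟨ s ⟩) = cong₂ _⟨_⟩ (simplify-rename d ρ t) (simplify-rename d ρ s)
simplify-rename d ρ (_·_ {A = A} {B = B} t s) =
  case mabs? t ×-dec (height (A ⇒ B) ≟ d) of λ where
    (yes (p , h≡d)) →
      trans (simplify-contract d (rename-mabs ρ p) (rename ρ s) h≡d)
      (trans (contract-cong (simplify-mabs d (rename-mabs ρ p))
               (rename-mabs ρ (simplify-mabs d p)) IHt IHs)
      (sym (trans (cong (rename ρ) (simplify-contract d p s h≡d))
                  (contract-rename ρ (simplify-mabs d p) (simplify d s)))))
    (no ¬p) →
      -- A renaming puts variables for variables, so it creates no redex.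
      trans (simplify-nonredex d (rename ρ t) (rename ρ s)
              λ { (p , h≡d) → ¬p (rename-mabs⁻ ρ t p , h≡d) })
      (trans (cong₂ _·_ IHt IHs)
             (cong (rename ρ) (sym (simplify-nonredex d t s ¬p))))
  where
  IHt = simplify-rename d ρ t
  IHs = simplify-rename d ρ s

-- σ creates no redex of degree d.
Inert : ℕ → Sub Γ Δ → Set
Inert {Γ = Γ} d σ = ∀ {A B} (x : A ⇒ B ∈ Γ) → MAbs (σ x) → height (A ⇒ B) ≢ d

inert-ext : ∀ {d} (σ : Sub Γ Δ) → Inert d σ → Inert d (ext {C = C} σ)
-- The bound variable is mapped to a variable, which is no m-abstraction; only `there` remains.
inert-ext σ inert (there x) p = inert x (rename-mabs⁻ there (σ x) p)

inert-single : ∀ {d} (s : Γ ⊢ᵐ C) → height C < d → Inert d (single s)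
inert-single s h<d (here refl) _ = <⇒≢ h<d

-- Only a variable could turn into a new m-abstraction, and `Inert` excludes this at height `d`.
subst-mabs⁻ : ∀ {d} (σ : Sub Γ Δ) → Inert d σ → (t : Γ ⊢ᵐ A ⇒ B) →
              height (A ⇒ B) ≡ d → MAbs (subst σ t) → MAbs t
subst-mabs⁻ σ inert (` x)     h≡d p         = contradiction h≡d (inert x p)
subst-mabs⁻ σ inert (ƛ t)     h≡d _         = ƛ t
subst-mabs⁻ σ inert (t ⟨ s ⟩) h≡d (p ⟨ _ ⟩) = subst-mabs⁻ σ inert t h≡d p ⟨ s ⟩

simplify-subst : ∀ d (σ : Sub Γ Δ) → Inert d σ → (t : Γ ⊢ᵐ A) →
                 simplify d (subst σ t) ≡ subst (λ x → simplify d (σ x)) (simplify d t)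
simplify-subst d σ inert (` x)     = refl
simplify-subst d σ inert (ƛ t)     = cong ƛ_
  (trans (simplify-subst d (ext σ) (inert-ext σ inert) t)
         (subst-cong (λ { (here _) → refl ; (there x) → simplify-rename d there (σ x) })
                     (simplify d t)))
simplify-subst d σ inert (t ⟨ s ⟩) =
  cong₂ _⟨_⟩ (simplify-subst d σ inert t) (simplify-subst d σ inert s)
simplify-subst {Γ = Γ} {Δ = Δ} d σ inert (_·_ {A = A} {B = B} t s) =
  case mabs? t ×-dec (height (A ⇒ B) ≟ d) of λ where
    (yes (p , h≡d)) →
      trans (simplify-contract d (subst-mabs σ p) (subst σ s) h≡d)
      (trans (contract-cong (simplify-mabs d (subst-mabs σ p))
               (subst-mabs τ (simplify-mabs d p)) IHt IHs)
      (sym (trans (cong (subst τ) (simplify-contract d p s h≡d))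
                  (contract-subst τ (simplify-mabs d p) (simplify d s)))))
    (no ¬p) →
      trans (simplify-nonredex d (subst σ t) (subst σ s)
              λ { (p , h≡d) → ¬p (subst-mabs⁻ σ inert t h≡d p , h≡d) })
      (trans (cong₂ _·_ IHt IHs)
             (cong (subst τ) (sym (simplify-nonredex d t s ¬p))))
  where
  τ : Sub Γ Δ
  τ x = simplify d (σ x)
  IHt = simplify-subst d σ inert t
  IHs = simplify-subst d σ inert s

-- Meant for the argument of a redex of degree at most `d`: its type is lower than `d`, so
-- substituting it creates no redex of degree `d`.
simplify-[] : ∀ d (t : C ∷ Γ ⊢ᵐ A) (s : Γ ⊢ᵐ C) → height C < d →
              simplify d (t [ s ]) ≡ simplify d t [ simplify d s ]
simplify-[] d t s h<d =
  trans (simplify-subst d (single s) (inert-single s h<d) t)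
        (subst-cong (λ { (here refl) → refl ; (there x) → refl }) (simplify d t))

-- Contraction in one degree and erasure

infix 4 _⊒[_,_]_

-- If the flag is true, then at least one contraction or erasure is performed;
-- if it is false, nothing is claimed.
data _⊒[_,_]_ {Base : Set} {Γ : Ctx Base} : ∀ {A} → Γ ⊢ᵐ A → ℕ → Bool → Γ ⊢ᵐ A → Set where
  `_    : ∀ {k A} (x : A ∈ Γ) → ` x ⊒[ k , false ] ` x
  ƛ_    : ∀ {k b A B} {t t′ : A ∷ Γ ⊢ᵐ B} → t ⊒[ k , b ] t′ → ƛ t ⊒[ k , b ] ƛ t′
  _·_   : ∀ {k b c A B} {t t′ : Γ ⊢ᵐ A ⇒ B} {s s′ : Γ ⊢ᵐ A} →
          t ⊒[ k , b ] t′ → s ⊒[ k , c ] s′ → t · s ⊒[ k , b ∨ c ] t′ · s′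
  _⟨_⟩  : ∀ {k b c A B} {t t′ : Γ ⊢ᵐ A} {s s′ : Γ ⊢ᵐ B} →
          t ⊒[ k , b ] t′ → s ⊒[ k , c ] s′ → t ⟨ s ⟩ ⊒[ k , b ∨ c ] t′ ⟨ s′ ⟩
  erase : ∀ {k b e A B} {t t′ : Γ ⊢ᵐ A} {s : Γ ⊢ᵐ B} →
          t ⊒[ k , b ] t′ → t ⟨ s ⟩ ⊒[ k , e ] t′
  -- The reduct of `t` is a bare abstraction, so its memory is lost. The step is parallel, as
  -- substitution can copy and nest redexes of degree `k`.
  beta  : ∀ {k b c e A B} {t : Γ ⊢ᵐ A ⇒ B} {u : A ∷ Γ ⊢ᵐ B} {s s′ : Γ ⊢ᵐ A} →
          MAbs t → height (A ⇒ B) ≡ k →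
          t ⊒[ k , b ] ƛ u → s ⊒[ k , c ] s′ → t · s ⊒[ k , e ] u [ s′ ]

private variable
  k   : ℕ
  b c : Bool

⊒-refl : (t : Γ ⊢ᵐ A) → t ⊒[ k , false ] t
⊒-refl (` x)     = ` x
⊒-refl (ƛ t)     = ƛ ⊒-refl t
⊒-refl (t · s)   = ⊒-refl t · ⊒-refl s
⊒-refl (t ⟨ s ⟩) = ⊒-refl t ⟨ ⊒-refl s ⟩

⊒-weaken : {t t′ : Γ ⊢ᵐ A} → t ⊒[ k , b ] t′ → t ⊒[ k , false ] t′
⊒-weaken (` x)          = ` x
⊒-weaken (ƛ q)          = ƛ ⊒-weaken q
⊒-weaken (q · r)        = ⊒-weaken q · ⊒-weaken r
⊒-weaken (q ⟨ r ⟩)      = ⊒-weaken q ⟨ ⊒-weaken r ⟩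
⊒-weaken (erase q)      = erase q
⊒-weaken (beta p h q r) = beta p h q r

⊒-rename : (ρ : Ren Γ Δ) {t t′ : Γ ⊢ᵐ A} → t ⊒[ k , b ] t′ →
           rename ρ t ⊒[ k , b ] rename ρ t′
⊒-rename ρ (` x)     = ` ρ x
⊒-rename ρ (ƛ q)     = ƛ ⊒-rename (extᴿ ρ) q
⊒-rename ρ (q · r)   = ⊒-rename ρ q · ⊒-rename ρ r
⊒-rename ρ (q ⟨ r ⟩) = ⊒-rename ρ q ⟨ ⊒-rename ρ r ⟩
⊒-rename ρ (erase q) = erase (⊒-rename ρ q)
⊒-rename ρ (beta {u = u} {s′ = s′} p h q r) =
  ≡.subst (_ ⊒[ _ , _ ]_) (sym (rename-[] ρ u s′))
    (beta (rename-mabs ρ p) h (⊒-rename ρ q) (⊒-rename ρ r))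

⊒-subst : {σ τ : Sub Γ Δ} → (∀ {A} (x : A ∈ Γ) → σ x ⊒[ k , false ] τ x) →
          {t t′ : Γ ⊢ᵐ A} → t ⊒[ k , b ] t′ → subst σ t ⊒[ k , b ] subst τ t′
⊒-subst σ⊒τ (` x)     = σ⊒τ x
⊒-subst σ⊒τ (ƛ q)     =
  ƛ ⊒-subst (λ { (here e) → ` here e ; (there x) → ⊒-rename there (σ⊒τ x) }) q
⊒-subst σ⊒τ (q · r)   = ⊒-subst σ⊒τ q · ⊒-subst σ⊒τ r
⊒-subst σ⊒τ (q ⟨ r ⟩) = ⊒-subst σ⊒τ q ⟨ ⊒-subst σ⊒τ r ⟩
⊒-subst σ⊒τ (erase q) = erase (⊒-subst σ⊒τ q)
⊒-subst {σ = σ} {τ = τ} σ⊒τ (beta {u = u} {s′ = s′} p h q r) =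
  ≡.subst (_ ⊒[ _ , _ ]_) (sym (subst-[] τ u s′))
    (beta (subst-mabs σ p) h (⊒-subst σ⊒τ q) (⊒-subst σ⊒τ r))

-- The flag of the argument is given up, since the substituted variable need not occur.
⊒-[] : {t t′ : C ∷ Γ ⊢ᵐ A} {s s′ : Γ ⊢ᵐ C} → t ⊒[ k , b ] t′ → s ⊒[ k , c ] s′ →
       t [ s ] ⊒[ k , b ] t′ [ s′ ]
⊒-[] q r = ⊒-subst (λ { (here refl) → ⊒-weaken r ; (there x) → ` x }) q

-- Redexes and simplification of related terms

⊒-mabs : {t t′ : Γ ⊢ᵐ A ⇒ B} → t ⊒[ k , b ] t′ → MAbs t → MAbs t′
⊒-mabs (ƛ q)     (ƛ _)     = ƛ _
⊒-mabs (q ⟨ r ⟩) (p ⟨ _ ⟩) = ⊒-mabs q p ⟨ _ ⟩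
⊒-mabs (erase q) (p ⟨ _ ⟩) = ⊒-mabs q p

height-cod<height : (A B : Ty Base) → height B < height (A ⇒ B)
height-cod<height A B = s≤s (m≤n⊔m (height A) (height B))

height-dom<height : (A B : Ty Base) → height A < height (A ⇒ B)
height-dom<height A B = s≤s (m≤m⊔n (height A) (height B))

-- A contraction of degree k yields a term whose type has height below k.
⊒-mabs⁻ : {t t′ : Γ ⊢ᵐ A ⇒ B} → k ≤ height (A ⇒ B) → t ⊒[ k , b ] t′ → MAbs t′ → MAbs t
⊒-mabs⁻ k≤h (ƛ q)     _         = ƛ _
⊒-mabs⁻ k≤h (q ⟨ r ⟩) (p ⟨ _ ⟩) = ⊒-mabs⁻ k≤h q p ⟨ _ ⟩
⊒-mabs⁻ k≤h (erase q) p         = ⊒-mabs⁻ k≤h q p ⟨ _ ⟩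
⊒-mabs⁻ {A = A₂} {B = B₂} k≤h (beta {A = A} _ refl _ _) _ =
  contradiction k≤h (<⇒≱ (height-cod<height A (A₂ ⇒ B₂)))

-- Contraction puts the argument inside the memory, whereas in an application it comes after the
-- memory; the flags are reordered accordingly.
∨-swapʳ : ∀ a b c → (a ∨ b) ∨ c ≡ (a ∨ c) ∨ b
∨-swapʳ a b c = trans (∨-assoc a b c) (trans (cong (a ∨_) (∨-comm b c)) (sym (∨-assoc a c b)))

⊒-contract : {t t′ : Γ ⊢ᵐ A ⇒ B} {s s′ : Γ ⊢ᵐ A} (p : MAbs t) (p′ : MAbs t′) →
             t ⊒[ k , b ] t′ → s ⊒[ k , c ] s′ →
             contract p s ⊒[ k , b ∨ c ] contract p′ s′
-- The wrapper keeps a copy of the argument, and with it the flag `c` that the substitution loses.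
⊒-contract (ƛ _) (ƛ _) (ƛ q) r = ⊒-[] q r ⟨ r ⟩
⊒-contract {c = c} (p ⟨ _ ⟩) (p′ ⟨ _ ⟩) (_⟨_⟩ {b = b₁} {c = b₂} q q′) r =
  ≡.subst (λ e → _ ⊒[ _ , e ] _) (∨-swapʳ b₁ c b₂) (⊒-contract p p′ q r ⟨ q′ ⟩)
⊒-contract (p ⟨ _ ⟩) p′ (erase q) r = erase (⊒-contract p p′ q r)

-- All memory of `t` is erased on the way to `ƛ u`, and so is the wrapper of the argument. Hence the
-- last step is always an `erase`, which permits any flag `e`.
contract-⊒-[] : ∀ {e} {t : Γ ⊢ᵐ A ⇒ B} {u : A ∷ Γ ⊢ᵐ B} {s s′ : Γ ⊢ᵐ A} (p : MAbs t) →
                t ⊒[ k , b ] ƛ u → s ⊒[ k , c ] s′ → contract p s ⊒[ k , e ] u [ s′ ]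
contract-⊒-[] (ƛ _)     (ƛ q)     r = erase (⊒-[] q r)
contract-⊒-[] (p ⟨ _ ⟩) (erase q) r = erase (contract-⊒-[] {e = false} p q r)

-- The degree j remaining after S_d is k if d > k, and 0 (no contraction at
-- all) if d = k.
⊒-simplify : ∀ {d j} → k ≤ d → (k < d × j ≡ k) ⊎ (k ≡ d × j ≡ 0) →
             {t t′ : Γ ⊢ᵐ A} → t ⊒[ k , b ] t′ →
             simplify d t ⊒[ j , b ] simplify d t′
⊒-simplify k≤d m (` x)     = ` x
⊒-simplify k≤d m (ƛ q)     = ƛ ⊒-simplify k≤d m q
⊒-simplify k≤d m (q ⟨ r ⟩) = ⊒-simplify k≤d m q ⟨ ⊒-simplify k≤d m r ⟩
⊒-simplify k≤d m (erase q) = erase (⊒-simplify k≤d m q)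
⊒-simplify {d = d} k≤d m (_·_ {A = A} {B = B} {t = t} {t′} {s} {s′} q r)
  with mabs? t ×-dec (height (A ⇒ B) ≟ d)
-- `t′` is still an m-abstraction, so both sides are contracted. The `with` has unfolded `simplify`
-- on the left only.
... | yes (p , refl) = ≡.subst₂ (_⊒[ _ , _ ]_)
  (sym (simplifyBody-contract d p (simplify d s)))
  (sym (simplify-contract d (⊒-mabs q p) s′ refl))
  (⊒-contract _ _ (⊒-simplify k≤d m q) (⊒-simplify k≤d m r))
-- As `k ≤ d`, contraction in degree `k` creates no redex of degree `d`, so neither side is
-- contracted.
... | no ¬p = ≡.subst (_ ⊒[ _ , _ ]_)
  (sym (simplify-nonredex d t′ s′
    λ { (p , refl) → ¬p (⊒-mabs⁻ k≤d q p , refl) }))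
  (⊒-simplify k≤d m q · ⊒-simplify k≤d m r)
-- The redex has degree `k < d` and survives the simplification, to be contracted afterwards.
⊒-simplify {d = d} k≤d m@(inj₁ (k<d , refl))
  (beta {A = A} {B = B} {t = t} {u} {s} {s′} p refl q r) = ≡.subst₂ (_⊒[ _ , _ ]_)
  (sym (simplify-nonredex d t s λ { (_ , h≡d) → <⇒≢ k<d h≡d }))
  (sym (simplify-[] d u s′ (<-≤-trans (height-dom<height A B) k≤d)))
  (beta (simplify-mabs d p) refl (⊒-simplify k≤d m q) (⊒-simplify k≤d m r))
-- Now the simplification contracts the redex itself; what it keeps in wrappers is erased.
⊒-simplify {d = d} k≤d m@(inj₂ (k≡d , refl))
  (beta {A = A} {B = B} {t = t} {u} {s} {s′} p refl q r) = ≡.subst₂ (_⊒[ _ , _ ]_)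
  (sym (simplify-contract d p s k≡d))
  (sym (simplify-[] d u s′ (<-≤-trans (height-dom<height A B) k≤d)))
  (contract-⊒-[] (simplify-mabs d p) (⊒-simplify k≤d m q) (⊒-simplify k≤d m r))

-- The degree stays `k` down to the round of degree `k`, which turns it into 0; all later rounds
-- have positive degree and keep it there.
⊒-simplifyFrom : ∀ D → k ≤ D → {t t′ : Γ ⊢ᵐ A} → t ⊒[ k , b ] t′ →
                 simplifyFrom D t ⊒[ 0 , b ] simplifyFrom D t′
⊒-simplifyFrom zero    z≤n q = q
⊒-simplifyFrom (suc D) k≤D q with m≤n⇒m<n∨m≡n k≤D
... | inj₁ k<D = ⊒-simplifyFrom D (s≤s⁻¹ k<D) (⊒-simplify k≤D (inj₁ (k<D , refl)) q)
... | inj₂ k≡D = ⊒-simplifyFrom D z≤n (⊒-simplify k≤D (inj₂ (k≡D , refl)) q)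

-- The maximal degree

redexDegree-mabs : {t : Γ ⊢ᵐ A ⇒ B} (s : Γ ⊢ᵐ A) → MAbs t → redexDegree t s ≡ height (A ⇒ B)
redexDegree-mabs {t = t} s p with mabs? t
... | yes _ = refl
... | no ¬p = contradiction p ¬p

simplify-maxdeg< : ∀ {d} (t : Γ ⊢ᵐ A) → maxdeg t < d → simplify d t ≡ t
simplify-maxdeg< (` x)     _ = refl
simplify-maxdeg< (ƛ t)     l = cong ƛ_ (simplify-maxdeg< t l)
simplify-maxdeg< (t · s)   l =
  trans (simplify-nonredex _ t s
          -- A redex of degree `d` here would contradict `maxdeg (t · s) < d`.
          λ { (p , refl) → <⇒≢ (m⊔n<o⇒m<o _ _ l) (redexDegree-mabs s p) })
        (cong₂ _·_ (simplify-maxdeg< t (m⊔n<o⇒m<o _ _ l′))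
                   (simplify-maxdeg< s (m⊔n<o⇒n<o (maxdeg t) _ l′)))
  where l′ = m⊔n<o⇒n<o (redexDegree t s) _ l
simplify-maxdeg< (t ⟨ s ⟩) l =
  cong₂ _⟨_⟩ (simplify-maxdeg< t (m⊔n<o⇒m<o _ _ l))
             (simplify-maxdeg< s (m⊔n<o⇒n<o (maxdeg t) _ l))

-- Rounds above the maximal degree change nothing. This lets two terms of different maximal degrees
-- be simplified from a common start.
simplifyFrom-≥maxdeg : ∀ D (t : Γ ⊢ᵐ A) → maxdeg t ≤ D → simplifyFrom D t ≡ simplify* t
simplifyFrom-≥maxdeg D t l with m≤n⇒m<n∨m≡n l
simplifyFrom-≥maxdeg D       t l | inj₂ e  = cong (λ n → simplifyFrom n t) (sym e)
simplifyFrom-≥maxdeg (suc D) t l | inj₁ l′ =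
  trans (cong (simplifyFrom D) (simplify-maxdeg< t l′)) (simplifyFrom-≥maxdeg D t (s≤s⁻¹ l′))

-- Weights

-- The decrease in weight that a flag guarantees.
⟦_⟧ : Bool → ℕ
⟦ false ⟧ = 0
⟦ true ⟧  = 1

⟦∨⟧≤ : ∀ b c → ⟦ b ∨ c ⟧ ≤ ⟦ b ⟧ + ⟦ c ⟧
⟦∨⟧≤ false c = ≤-refl
⟦∨⟧≤ true  c = s≤s z≤n

⟦⟧≤1 : ∀ b → ⟦ b ⟧ ≤ 1
⟦⟧≤1 false = z≤n
⟦⟧≤1 true  = ≤-refl

⟦∨⟧+-mono-≤ : ∀ b c {m m′ n n′} → ⟦ b ⟧ + m′ ≤ m → ⟦ c ⟧ + n′ ≤ n →
              ⟦ b ∨ c ⟧ + (m′ + n′) ≤ m + n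
⟦∨⟧+-mono-≤ b c {m} {m′} {n} {n′} l l′ = begin
  ⟦ b ∨ c ⟧ + (m′ + n′)         ≤⟨ +-monoˡ-≤ (m′ + n′) (⟦∨⟧≤ b c) ⟩
  ⟦ b ⟧ + ⟦ c ⟧ + (m′ + n′)     ≡⟨ +-interchange ⟦ b ⟧ ⟦ c ⟧ m′ n′ ⟩
  (⟦ b ⟧ + m′) + (⟦ c ⟧ + n′)   ≤⟨ +-mono-≤ l l′ ⟩
  m + n                         ∎
  where
  open ≤-Reasoning
  open import Algebra.Properties.CommutativeSemigroup +-commutativeSemigroup
    renaming (interchange to +-interchange)

⊒-weight : {t t′ : Γ ⊢ᵐ A} → t ⊒[ 0 , b ] t′ → ⟦ b ⟧ + weight t′ ≤ weight t
⊒-weight (` x)   = z≤n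
⊒-weight (ƛ q)   = ⊒-weight q
⊒-weight (_·_ {b = b} {c} q r) = ⟦∨⟧+-mono-≤ b c (⊒-weight q) (⊒-weight r)
⊒-weight (_⟨_⟩ {b = b} {c} q r) =
  ≤-trans (≤-reflexive (+-suc ⟦ b ∨ c ⟧ _)) (s≤s (⟦∨⟧+-mono-≤ b c (⊒-weight q) (⊒-weight r)))
-- The erased wrapper itself pays for the flag `e`.
⊒-weight (erase {b = b} {e = e} q) =
  +-mono-≤ (⟦⟧≤1 e) (m≤n⇒m≤n+o _ (m+n≤o⇒n≤o ⟦ b ⟧ (⊒-weight q)))
-- Arrow types have positive height, so nothing is contracted in degree 0.
⊒-weight (beta _ () _ _)

-- Embedding of the λ-calculus

⌜rename⌝ : (ρ : Ren Γ Δ) (M : Γ ⊢ A) → ⌜ STLC.rename ρ M ⌝ ≡ rename ρ ⌜ M ⌝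
⌜rename⌝ ρ (STLC.` x)   = refl
⌜rename⌝ ρ (STLC.ƛ M)   = cong ƛ_ (⌜rename⌝ (extᴿ ρ) M)
⌜rename⌝ ρ (M STLC.· N) = cong₂ _·_ (⌜rename⌝ ρ M) (⌜rename⌝ ρ N)

⌜subst⌝ : (σ : STLC.Sub Γ Δ) (M : Γ ⊢ A) → ⌜ STLC.subst σ M ⌝ ≡ subst (λ x → ⌜ σ x ⌝) ⌜ M ⌝
⌜subst⌝ σ (STLC.` x)   = refl
⌜subst⌝ σ (STLC.ƛ M)   = cong ƛ_
  (trans (⌜subst⌝ (STLC.ext σ) M)
         (subst-cong (λ { (here _) → refl ; (there x) → ⌜rename⌝ there (σ x) }) ⌜ M ⌝))
⌜subst⌝ σ (M STLC.· N) = cong₂ _·_ (⌜subst⌝ σ M) (⌜subst⌝ σ N)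

⌜[]⌝ : (M : C ∷ Γ ⊢ A) (N : Γ ⊢ C) → ⌜ M STLC.[ N ] ⌝ ≡ ⌜ M ⌝ [ ⌜ N ⌝ ]
⌜[]⌝ M N = trans (⌜subst⌝ (STLC.single N) M)
  (subst-cong (λ { (here refl) → refl ; (there x) → refl }) ⌜ M ⌝)

-- The witness `k` is the degree of the contracted redex. The flag is set at `beta` and passes
-- through the context by disjunction with the `false` of `⊒-refl`.
→β⇒⊒ : {M N : Γ ⊢ A} → M →β N → ∃ λ k → ⌜ M ⌝ ⊒[ k , true ] ⌜ N ⌝
→β⇒⊒ (STLC.β {M = M} {N}) = _ , ≡.subst ((ƛ ⌜ M ⌝) · ⌜ N ⌝ ⊒[ _ , true ]_) (sym (⌜[]⌝ M N))
  (beta (ƛ ⌜ M ⌝) refl (ƛ ⊒-refl ⌜ M ⌝) (⊒-refl ⌜ N ⌝))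
→β⇒⊒ (STLC.ξƛ r)          = let k , q = →β⇒⊒ r in k , ƛ q
→β⇒⊒ (STLC.ξ·ˡ {N = N} r) = let k , q = →β⇒⊒ r in k , q · ⊒-refl ⌜ N ⌝
→β⇒⊒ (STLC.ξ·ʳ {M = M} r) = let k , q = →β⇒⊒ r in k , ⊒-refl ⌜ M ⌝ · q

theorem15 : {Base : Set} {Γ : Ctx Base} {A : Ty Base} {M N : Γ ⊢ A} → M →β N → 𝒲 M > 𝒲 N
theorem15 {M = M} {N} r with →β⇒⊒ r
... | k , q = ≡.subst₂ (λ t t′ → weight t > weight t′)
  (simplifyFrom-≥maxdeg D ⌜ M ⌝ (m≤n⇒m≤o⊔n k (m≤m⊔n (maxdeg ⌜ M ⌝) (maxdeg ⌜ N ⌝))))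
  (simplifyFrom-≥maxdeg D ⌜ N ⌝ (m≤n⇒m≤o⊔n k (m≤n⊔m (maxdeg ⌜ M ⌝) (maxdeg ⌜ N ⌝))))
  (⊒-weight (⊒-simplifyFrom D (m≤m⊔n k _) q))
  -- A common starting degree for both terms, with `k` included so that `k ≤ D` is immediate.
  where D = k ⊔ (maxdeg ⌜ M ⌝ ⊔ maxdeg ⌜ N ⌝)
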